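{- For $f\in\mathbf{B}_{k,n}$, $P\in\mathcal{P}_{k,n}$ and $A\in\operatorname{Deo}^{\max}_{f,P}$, the Deograph $G(A)$ is a forest. Moreover, its connected components are precisely the supports of the cycles of $\overline f$.
   Context: Let $n\ge 1$, $0\le k\le n$, $[n]=\{1,\dots,n\}$. An $n$-periodic affine permutation is a bijection $f:\mathbb{Z}\to\mathbb{Z}$ with $f(i+n)=f(i)+n$ for all $i$. $\mathbf{B}_{k,n}$ is the set of those with $\frac1n\sum_{i=1}^n(f(i)-i)=k$ and $i\le f(i)\le i+n$ for all $i$. $\overline f\in S_n$ is $f$ reduced modulo $n$, and $c(\overline f)$ is its number of cycles (fixed points included, with support a single element). Lattice paths: $\mathcal{P}_{k,n}$ is the set of lattice paths $P$ from $(0,0)$ to $(n-k,k)$ with unit steps $P_1,\dots,P_n\in\{\mathrm R,\mathrm U\}$ (right, up). Extend $P$ to a bi-infinite path with steps indexed by $\mathbb{Z}$ via $P_{i+n}=P_i$ (step $1$ starts at $(0,0)$); it is invariant under translation by $(n-k,k)$. The strip of $P$ is the region between the extended path $P$ (southern boundary) and its translate $P+(0,k)$ (northern boundary). On each boundary the unit edges are labeled by $\mathbb{Z}$: the southern edge labeled $i$ is step $i$ of $P$, and the northern edge labeled $i$ is its translate by $(0,k)$. Fillings: a periodic filling assigns to each unit box of the strip a crossing or an elbow, invariantly under translation by $(n-k,k)$. Strands enter at the northern boundary edges (a strand is labeled by the index of its northern edge) and travel right/down: in a crossing box a strand entering from the left exits right and one entering from the top exits at the bottom; in an elbow box a strand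 entering from the left exits at the bottom and one entering from the top exits right. The strand permutation sends $i$ to $j$ if the strand entering at northern edge $i$ exits at southern edge $j$. An $(f,P)$-affine Deogram is a periodic filling with strand permutation $f$ such that whenever two strands form an elbow in a box, they have crossed each other an even number of times in boxes traversed before it (counting from the northern boundary). $\operatorname{Deo}^{\max}_{f,P}$ is the set of those having exactly $n-c(\overline f)$ elbows modulo translation by $(n-k,k)$. The Deograph $G(A)$ is the multigraph with vertex set $[n]$ and one edge for each elbow of $A$ modulo translation by $(n-k,k)$, joining the labels modulo $n$ of the two strands forming that elbow. (A multigraph is a forest if it has no cycles; in particular no loops and no parallel edges.) -}

module Defs where

open import Data.Fin.Base using (Fin; toℕ; fromℕ<)
open import Data.Fin.Permutation using (Permutation′; permutation; _⟨$⟩ʳ_)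
open import Data.Fin.Properties using (toℕ<n; toℕ-fromℕ<; toℕ-injective)
open import Data.Fin.Subset using (Subset; ⁅_⁆; ⋃) renaming (_∈_ to _∈ₛ_)
open import Data.Integer.Base
  using (ℤ; +_; -[1+_]; +[1+_]; 0ℤ; 1ℤ; _+_; _-_; -_; _*_; _≤_; ∣_∣)
open import Data.Integer.DivMod using (_%ℕ_; _/ℕ_; n%ℕd<d; a≡a%ℕn+[a/ℕn]*n)
open import Data.Integer.Tactic.RingSolver using (solve-∀)
open import Data.List.Base using (List; []; _∷_; length; map; filter; deduplicate; allFin; iterate)
open import Data.Nat.Base as ℕ using (ℕ; zero; suc; NonZero)
open import Data.Nat.Divisibility using (_∣_; divides; >⇒∤)
open import Data.Product.Base using (∃-syntax; _×_; _,_; proj₁; proj₂)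
open import Data.Rational.Base as ℚ using ()
open import Data.Sum.Base using (_⊎_)
open import Data.Vec.Base using (Vec; lookup)
open import Function.Bundles using (_⤖_; _⇔_; module Bijection; Inverse)
open import Level using (0ℓ)
open import Relation.Binary.Bundles using (Setoid)
open import Relation.Binary.Definitions using (DecidableEquality)
open import Relation.Binary.PropositionalEquality
  using (_≡_; _≢_; refl; sym; trans; cong; cong₂; subst; setoid; module ≡-Reasoning)
open import Relation.Nullary.Decidable using (yes; no; _×-dec_)
open import Relation.Nullary.Negation using (¬_; contradiction)

import Algebra.Properties.CommutativeMonoid.Sum
import Data.Bool.Properties as Bool
import Data.Integer.Properties as ℤ
import Data.List.Membership.DecPropositional
import Data.List.Relation.Unary.Unique.Propositional as Propositional
import Data.List.Relation.Unary.Unique.Setoid as Setoidal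
import Data.Nat.Properties as ℕ
import Data.Product.Properties as Product
import Data.Vec.Properties as Vec

open Algebra.Properties.CommutativeMonoid.Sum ℤ.+-0-commutativeMonoid using (sum)

-- The element j of Fin n stands for the label toℕ j + 1 of
-- [n] = {1, …, n}; residue sends an integer to its representative in [n].

label : ∀ {n} → Fin n → ℤ
label j = 1ℤ + + toℕ j

residue : ∀ {n} .{{_ : NonZero n}} → ℤ → Fin n
residue {n} i = fromℕ< (n%ℕd<d (i - 1ℤ) n)

module _ {n : ℕ} .{{_ : NonZero n}} where

  label-residue : ∀ i → ∃[ t ] i ≡ label {n} (residue i) + t * + n
  label-residue i = (i - 1ℤ) /ℕ n , (begin
    i                                                  ≡⟨ lemma₁ i ⟩
    1ℤ + (i - 1ℤ)                                      ≡⟨ cong (λ z → 1ℤ + z) (a≡a%ℕn+[a/ℕn]*n (i - 1ℤ) n) ⟩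
    1ℤ + (+ r + q * + n)                               ≡⟨ ℤ.+-assoc 1ℤ (+ r) (q * + n) ⟨
    (1ℤ + + r) + q * + n                               ≡⟨ cong (λ s → (1ℤ + + s) + q * + n) (toℕ-fromℕ< (n%ℕd<d (i - 1ℤ) n)) ⟨
    label {n} (residue i) + q * + n                    ∎)
    where
    open ≡-Reasoning
    r = (i - 1ℤ) %ℕ n
    q = (i - 1ℤ) /ℕ n
    lemma₁ : ∀ a → a ≡ 1ℤ + (a - 1ℤ)
    lemma₁ = solve-∀

  label-injective-mod : ∀ (a b : Fin n) t → label a ≡ label b + t * + n → a ≡ b
  label-injective-mod a b t eq = toℕ-injective (ℤ.+-injective (ℤ.i-j≡0⇒i≡j (+ toℕ a) (+ toℕ b) (ℤ.∣i∣≡0⇒i≡0 diff≡0)))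
    where
    δ : ℤ
    δ = + toℕ a - + toℕ b

    lemma₁ : ∀ x y → x - y ≡ (1ℤ + x) - (1ℤ + y)
    lemma₁ = solve-∀
    lemma₂ : ∀ x y → (x + y) - x ≡ y
    lemma₂ = solve-∀

    δ≡ : δ ≡ t * + n
    δ≡ = trans (lemma₁ (+ toℕ a) (+ toℕ b)) (trans (cong (_- label b) eq) (lemma₂ (label b) (t * + n)))

    n∣δ : n ∣ ∣ δ ∣
    n∣δ = divides ∣ t ∣ (trans (cong ∣_∣ δ≡) (ℤ.abs-* t (+ n)))

    ∣δ∣<n : ∣ δ ∣ ℕ.< n
    ∣δ∣<n = ℕ.≤-<-trans
      (subst (ℕ._≤ toℕ a ℕ.⊔ toℕ b) (cong ∣_∣ (sym (ℤ.m-n≡m⊖n (toℕ a) (toℕ b)))) (ℤ.∣m⊝n∣≤m⊔n (toℕ a) (toℕ b)))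
      (ℕ.⊔-lub (toℕ<n a) (toℕ<n b))

    small : ∀ d → n ∣ d → d ℕ.< n → d ≡ 0
    small zero    _   _   = refl
    small (suc d) n∣d d<n = contradiction n∣d (>⇒∤ d<n)

    diff≡0 : ∣ δ ∣ ≡ 0
    diff≡0 = small ∣ δ ∣ n∣δ ∣δ∣<n

  residue-unique : ∀ {i} (a : Fin n) t → i ≡ label a + t * + n → residue i ≡ a
  residue-unique {i} a t eq = let (s , eq′) = label-residue i in
    label-injective-mod (residue i) a (t - s) (begin
      label (residue {n} i)                            ≡⟨ lemma₁ _ (s * + n) ⟩
      (label (residue {n} i) + s * + n) - s * + n      ≡⟨ cong (_- s * + n) (trans (sym eq′) eq) ⟩
      (label a + t * + n) - s * + n                    ≡⟨ lemma₂ (label a) t s (+ n) ⟩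
      label a + (t - s) * + n                          ∎)
    where
    open ≡-Reasoning
    lemma₁ : ∀ x y → x ≡ (x + y) - y
    lemma₁ = solve-∀
    lemma₂ : ∀ x t s m → (x + t * m) - s * m ≡ x + (t - s) * m
    lemma₂ = solve-∀

  residue-shift : ∀ i t → residue {n} (i + t * + n) ≡ residue i
  residue-shift i t = let (s , eq) = label-residue i in
    residue-unique (residue i) (s + t)
      (trans (cong (_+ t * + n) eq) (lemma (label (residue {n} i)) s t (+ n)))
    where
    lemma : ∀ x s t m → (x + s * m) + t * m ≡ x + (s + t) * m
    lemma = solve-∀

record AffinePermutation (n : ℕ) : Set where
  field
    bijection : ℤ ⤖ ℤ
  open Bijection bijection public using (injective; strictlySurjective) renaming (to to apply)
  field
    periodic : ∀ i → apply (i + + n) ≡ apply i + + n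

open AffinePermutation public using (apply)

module _ {n : ℕ} .{{_ : NonZero n}} where

  averageDisplacement : AffinePermutation n → ℚ.ℚ
  averageDisplacement f = sum {n} (λ j → apply f (label j) - label j) ℚ./ n

  record Bounded (k : ℕ) (f : AffinePermutation n) : Set where
    field
      average : averageDisplacement f ≡ + k ℚ./ 1
      lower   : ∀ i → i ≤ apply f i
      upper   : ∀ i → apply f i ≤ i + + n

  module _ (f : AffinePermutation n) where
    open AffinePermutation f using (periodic; injective; strictlySurjective)

    apply-shift : ∀ i t → apply f (i + t * + n) ≡ apply f i + t * + n
    apply-shift i (+ m) = go m
      where
      base : ∀ x y → x + 0ℤ * y ≡ x
      base = solve-∀
      next : ∀ x m y → x + (1ℤ + m) * y ≡ (x + m * y) + y
      next = solve-∀
      go : ∀ m → apply f (i + + m * + n) ≡ apply f i + + m * + n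
      go zero    = trans (cong (apply f) (base i (+ n))) (sym (base (apply f i) (+ n)))
      go (suc m) = begin
        apply f (i + + suc m * + n)        ≡⟨ cong (apply f) (next i (+ m) (+ n)) ⟩
        apply f ((i + + m * + n) + + n)    ≡⟨ periodic (i + + m * + n) ⟩
        apply f (i + + m * + n) + + n      ≡⟨ cong (_+ + n) (go m) ⟩
        (apply f i + + m * + n) + + n      ≡⟨ next (apply f i) (+ m) (+ n) ⟨
        apply f i + + suc m * + n          ∎
        where open ≡-Reasoning
    apply-shift i t@(-[1+ m ]) = begin
      apply f (i + t * + n)                                ≡⟨ lemma₁ _ (- t) (+ n) ⟩
      (apply f (i + t * + n) + - t * + n) - - t * + n      ≡⟨ cong (_- - t * + n) (apply-shift (i + t * + n) (- t)) ⟨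
      apply f ((i + t * + n) + - t * + n) - - t * + n      ≡⟨ cong (λ x → apply f x - - t * + n) (lemma₂ i t (+ n)) ⟩
      apply f i - - t * + n                                ≡⟨ lemma₃ (apply f i) t (+ n) ⟩
      apply f i + t * + n                                  ∎
      where
      open ≡-Reasoning
      lemma₁ : ∀ x s m → x ≡ (x + s * m) - s * m
      lemma₁ = solve-∀
      lemma₂ : ∀ x t m → (x + t * m) + - t * m ≡ x
      lemma₂ = solve-∀
      lemma₃ : ∀ x t m → x - - t * m ≡ x + t * m
      lemma₃ = solve-∀

    private
      preimage : ℤ → ℤ
      preimage j = proj₁ (strictlySurjective j)

      apply-preimage : ∀ j → apply f (preimage j) ≡ j
      apply-preimage j = proj₂ (strictlySurjective j)

      to from : Fin n → Fin n
      to   j = residue (apply f (label j))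
      from j = residue (preimage (label j))

      unshift : ∀ {x y z} → x ≡ y + z → y ≡ x + - z
      unshift {_} {y} {z} refl = lemma y z
        where
        lemma : ∀ y z → y ≡ (y + z) + - z
        lemma = solve-∀

      neg-* : ∀ t m → - (t * m) ≡ - t * m
      neg-* = solve-∀

      to-from : ∀ j → to (from j) ≡ j
      to-from j = let p = preimage (label j) ; (t , eq) = label-residue p in
        residue-unique j (- t) (begin
          apply f (label (from j))        ≡⟨ cong (apply f) (trans (unshift eq) (cong (λ z → p + z) (neg-* t (+ n)))) ⟩
          apply f (p + - t * + n)         ≡⟨ apply-shift p (- t) ⟩
          apply f p + - t * + n           ≡⟨ cong (_+ - t * + n) (apply-preimage (label j)) ⟩
          label j + - t * + n             ∎)
        where open ≡-Reasoning

      from-to : ∀ j → from (to j) ≡ j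
      from-to j = let q = apply f (label j) ; (t , eq) = label-residue q in
        residue-unique j (- t) (injective (begin
          apply f (preimage (label (to j)))   ≡⟨ apply-preimage (label (to j)) ⟩
          label (to j)                        ≡⟨ trans (unshift eq) (cong (λ z → q + z) (neg-* t (+ n))) ⟩
          q + - t * + n                       ≡⟨ apply-shift (label j) (- t) ⟨
          apply f (label j + - t * + n)       ∎))
        where open ≡-Reasoning

    reduce : Permutation′ n
    reduce = permutation to from to-from from-to

-- Every cycle has length at most n, so n iterates exhaust it.
cycleThrough : ∀ {n} → Permutation′ n → Fin n → Subset n
cycleThrough {n} π i = ⋃ (map ⁅_⁆ (iterate (π ⟨$⟩ʳ_) i n))

cycleSupports : ∀ {n} → Permutation′ n → List (Subset n)
cycleSupports {n} π = deduplicate (Vec.≡-dec Bool._≟_) (map (cycleThrough π) (allFin n))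

cycleCount : ∀ {n} → Permutation′ n → ℕ
cycleCount π = length (cycleSupports π)

-- The edges form a setoid, so that they can be orbits.  The order of the
-- two ends is irrelevant: see Joins.
record Multigraph (n : ℕ) : Set₁ where
  field
    edgeSetoid : Setoid 0ℓ 0ℓ
  open Setoid edgeSetoid public using (_≈_) renaming (Carrier to Edge)
  field
    ends      : Edge → Fin n × Fin n
    ends-cong : ∀ {e e′} → e ≈ e′ → ends e ≡ ends e′

  Joins : Edge → Fin n → Fin n → Set
  Joins e u v = ends e ≡ (u , v) ⊎ ends e ≡ (v , u)

  data Walk : Fin n → Fin n → Set where
    []     : ∀ {u} → Walk u u
    step   : ∀ {u v w} (e : Edge) → Joins e u v → Walk v w → Walk u w

  walkEdges : ∀ {u v} → Walk u v → List Edge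
  walkEdges []           = []
  walkEdges (step e _ w) = e ∷ walkEdges w

  -- All vertices of the walk except the last one.
  walkVertices : ∀ {u v} → Walk u v → List (Fin n)
  walkVertices []               = []
  walkVertices (step {u} _ _ w) = u ∷ walkVertices w

  -- A loop is a cycle of length 1, two parallel edges a cycle of length 2.
  record IsCycle {u : Fin n} (w : Walk u u) : Set where
    field
      nonempty         : walkEdges w ≢ []
      distinctEdges    : Setoidal.Unique edgeSetoid (walkEdges w)
      distinctVertices : Propositional.Unique (walkVertices w)

  IsForest : Set
  IsForest = ∀ {u} (w : Walk u u) → ¬ IsCycle w

  IsComponent : Subset n → Set
  IsComponent S = ∃[ v ] (∀ w → w ∈ₛ S ⇔ Walk v w)

open Multigraph public using (IsForest; IsComponent)

Point : Set
Point = ℤ × ℤ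

infixl 6 _⊕_ _⊖_
infixl 7 _⊙_

_⊕_ _⊖_ : Point → Point → Point
(x , y) ⊕ (x′ , y′) = x + x′ , y + y′
(x , y) ⊖ (x′ , y′) = x - x′ , y - y′

_⊙_ : ℤ → Point → Point
t ⊙ (x , y) = t * x , t * y

data Step : Set where
  R U : Step

displacement : Step → Point
displacement R = 1ℤ , 0ℤ
displacement U = 0ℤ , 1ℤ

module _ {n : ℕ} .{{_ : NonZero n}} where

  stepAt : Vec Step n → ℤ → Step
  stepAt P i = lookup P (residue i)

  -- vertexAt P i is the end of step i and the start of step i + 1.
  vertexAt : Vec Step n → ℤ → Point
  vertexAt P (+ zero)      = 0ℤ , 0ℤ
  vertexAt P +[1+ m ]      = vertexAt P (+ m) ⊕ displacement (stepAt P +[1+ m ])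
  vertexAt P -[1+ zero ]   = vertexAt P (+ 0) ⊖ displacement (stepAt P (+ 0))
  vertexAt P -[1+ suc m ]  = vertexAt P -[1+ m ] ⊖ displacement (stepAt P -[1+ m ])

-- The translation vector (n - k , k).
period : ℕ → ℕ → Point
period n k = + n - + k , + k

record LatticePath (n k : ℕ) .{{_ : NonZero n}} : Set where
  field
    steps    : Vec Step n
    endpoint : vertexAt steps (+ n) ≡ period n k

-- A unit edge is given by its left or lower endpoint and its direction,
-- a unit box by its lower left corner.
UnitEdge Box : Set
UnitEdge = Point × Step
Box      = Point

leftEdge rightEdge topEdge bottomEdge : Box → UnitEdge
leftEdge   b = b , U
rightEdge  b = b ⊕ (1ℤ , 0ℤ) , U
topEdge    b = b ⊕ (0ℤ , 1ℤ) , R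
bottomEdge b = b , R

data Tile : Set where
  crossing elbow : Tile

_≟ᵗ_ : DecidableEquality Tile
crossing ≟ᵗ crossing = yes refl
crossing ≟ᵗ elbow    = no λ ()
elbow    ≟ᵗ crossing = no λ ()
elbow    ≟ᵗ elbow    = yes refl

exitFromLeft exitFromTop : Tile → Box → UnitEdge
exitFromLeft crossing = rightEdge
exitFromLeft elbow    = bottomEdge
exitFromTop  crossing = bottomEdge
exitFromTop  elbow    = rightEdge

-- The boxes traversed by a strand together with their tiles.
Log : Set
Log = List (Box × Tile)

_≟ˡ_ : DecidableEquality (Box × Tile)
_≟ˡ_ = Product.≡-dec (Product.≡-dec ℤ._≟_ ℤ._≟_) _≟ᵗ_

open Data.List.Membership.DecPropositional _≟ˡ_ using (_∈?_)

-- Only two strands pass through a box, so two strands cross each other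
-- exactly in the crossing boxes that both of them traverse.
commonCrossings : Log → Log → ℕ
commonCrossings ℓ ℓ′ = length (filter (λ bt → (proj₂ bt ≟ᵗ crossing) ×-dec (bt ∈? ℓ′)) ℓ)

module _ {n k : ℕ} .{{_ : NonZero n}} (P : LatticePath n k) where
  open LatticePath P

  southEdge northEdge : ℤ → UnitEdge
  southEdge i = vertexAt steps (i - 1ℤ) , stepAt steps i
  northEdge i = vertexAt steps (i - 1ℤ) ⊕ (0ℤ , + k) , stepAt steps i

  -- The box lies above the southern edge i and below the northern edge i.
  InStrip : Box → Set
  InStrip (x , y) = ∃[ i ]
    stepAt steps i ≡ R ×
    proj₁ (vertexAt steps (i - 1ℤ)) ≡ x ×
    proj₂ (vertexAt steps (i - 1ℤ)) ≤ y ×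
    y + 1ℤ ≤ proj₂ (vertexAt steps (i - 1ℤ)) + + k

  record Filling : Set where
    field
      tile     : (b : Box) → .(InStrip b) → Tile
      periodic : ∀ b .(p : InStrip b) .(q : InStrip (b ⊕ period n k)) →
                 tile (b ⊕ period n k) q ≡ tile b p

module _ {n k : ℕ} .{{_ : NonZero n}} {P : LatticePath n k} (A : Filling P) where
  open Filling A using (tile)

  -- Reaches i e ℓ : the strand labeled i passes through the edge e, and
  -- ℓ lists the boxes it has traversed before e, the latest first.
  data Reaches (i : ℤ) : UnitEdge → Log → Set where
    start    : Reaches i (northEdge P i) []
    fromLeft : ∀ {b ℓ} (p : InStrip P b) → Reaches i (leftEdge b) ℓ →
               Reaches i (exitFromLeft (tile b p) b) ((b , tile b p) ∷ ℓ)
    fromTop  : ∀ {b ℓ} (p : InStrip P b) → Reaches i (topEdge b) ℓ →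
               Reaches i (exitFromTop (tile b p) b) ((b , tile b p) ∷ ℓ)

  HasStrandPermutation : AffinePermutation n → Set
  HasStrandPermutation f = ∀ i → ∃[ ℓ ] Reaches i (southEdge P (apply f i)) ℓ

  -- An elbow box together with the two strands forming the elbow, which
  -- are uniquely determined by the box.
  record Elbow : Set where
    field
      box                : Box
      inStrip            : InStrip P box
      isElbow            : tile box inStrip ≡ elbow
      leftLabel topLabel : ℤ
      leftLog topLog     : Log
      leftStrand         : Reaches leftLabel (leftEdge box) leftLog
      topStrand          : Reaches topLabel (topEdge box) topLog

  open Elbow

  -- Translation by (n - k , k) adds n to the labels of strands.
  _≈ᵉ_ : Elbow → Elbow → Set
  e ≈ᵉ e′ = ∃[ t ]
    box e′ ≡ box e ⊕ t ⊙ period n k ×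
    leftLabel e′ ≡ leftLabel e + t * + n ×
    topLabel e′ ≡ topLabel e + t * + n

  private
    add-zero : ∀ x y → x ≡ x + 0ℤ * y
    add-zero = solve-∀

    add-neg : ∀ x t y → x ≡ (x + t * y) + - t * y
    add-neg = solve-∀

    add-add : ∀ x s t y → (x + s * y) + t * y ≡ x + (s + t) * y
    add-add = solve-∀

    flip-shift : ∀ x {x′} t y → x′ ≡ x + t * y → x ≡ x′ + - t * y
    flip-shift x t y refl = add-neg x t y

    join-shift : ∀ x {x′ x″} s t y → x′ ≡ x + s * y → x″ ≡ x′ + t * y → x″ ≡ x + (s + t) * y
    join-shift x s t y refl refl = add-add x s t y

    x₀ y₀ : ℤ
    x₀ = proj₁ (period n k)
    y₀ = proj₂ (period n k)

    ≈ᵉ-refl : ∀ {e} → e ≈ᵉ e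
    ≈ᵉ-refl {e} = 0ℤ ,
      cong₂ _,_ (add-zero (proj₁ (box e)) x₀) (add-zero (proj₂ (box e)) y₀) ,
      add-zero (leftLabel e) (+ n) ,
      add-zero (topLabel e) (+ n)

    ≈ᵉ-sym : ∀ {e e′} → e ≈ᵉ e′ → e′ ≈ᵉ e
    ≈ᵉ-sym {e} (t , b , l , u) = - t ,
      cong₂ _,_ (flip-shift (proj₁ (box e)) t x₀ (cong proj₁ b))
                (flip-shift (proj₂ (box e)) t y₀ (cong proj₂ b)) ,
      flip-shift (leftLabel e) t (+ n) l ,
      flip-shift (topLabel e) t (+ n) u

    ≈ᵉ-trans : ∀ {e e′ e″} → e ≈ᵉ e′ → e′ ≈ᵉ e″ → e ≈ᵉ e″
    ≈ᵉ-trans {e} (s , b , l , u) (t , b′ , l′ , u′) = s + t ,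
      cong₂ _,_ (join-shift (proj₁ (box e)) s t x₀ (cong proj₁ b) (cong proj₁ b′))
                (join-shift (proj₂ (box e)) s t y₀ (cong proj₂ b) (cong proj₂ b′)) ,
      join-shift (leftLabel e) s t (+ n) l l′ ,
      join-shift (topLabel e) s t (+ n) u u′

  elbowSetoid : Setoid 0ℓ 0ℓ
  elbowSetoid = record
    { Carrier       = Elbow
    ; _≈_           = _≈ᵉ_
    ; isEquivalence = record
      { refl  = λ {e} → ≈ᵉ-refl {e}
      ; sym   = λ {e} {e′} → ≈ᵉ-sym {e} {e′}
      ; trans = λ {e} {e′} {e″} → ≈ᵉ-trans {e} {e′} {e″}
      }
    }

  HasElbowCount : ℕ → Set
  HasElbowCount m = Inverse (setoid (Fin m)) elbowSetoid

  record IsDeogram (f : AffinePermutation n) : Set where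
    field
      strandPermutation : HasStrandPermutation f
      distinguished     : ∀ (e : Elbow) → 2 ∣ commonCrossings (leftLog e) (topLog e)

  deograph : Multigraph n
  deograph = record
    { edgeSetoid = elbowSetoid
    ; ends       = λ e → residue (leftLabel e) , residue (topLabel e)
    ; ends-cong  = λ {e} (t , _ , l , u) → sym (cong₂ _,_
        (trans (cong residue l) (residue-shift (leftLabel e) t))
        (trans (cong residue u) (residue-shift (topLabel e) t)))
    }

  record IsMaximalDeogram (f : AffinePermutation n) : Set where
    field
      isDeogram  : IsDeogram f
      elbowCount : HasElbowCount (n ℕ.∸ cycleCount (reduce f))

{-# OPTIONS --safe #-}

-- Replacing every elbow by a crossing makes each strand run straight and end
-- at the label it started with modulo n.  Each elbow exchanges two strands
-- joined by an edge of the Deograph, so by induction along the strip every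
-- strand stays in the component of the straight line it currently follows;
-- hence each cycle of the reduced permutation lies in one component.  A
-- graph on n vertices with m edges has at least n - m components, and here
-- n - m is the number of cycles.  So no edge can be dropped and no two cycles
-- can be merged.

module Submission where

open import Defs
open import Data.Fin.Base using (Fin; zero; suc; punchIn; punchOut)
open import Data.Fin.Permutation using (Permutation′; _⟨$⟩ʳ_)
open import Data.Fin.Properties using (injective⇒≤; punchIn-punchOut; _≟_)
open import Data.Fin.Subset using (Subset; ⁅_⁆; ⋃) renaming (_∈_ to _∈ₛ_)
open import Data.Fin.Subset.Properties using (x∈p∪q⁻; x∈p∪q⁺; x∈⁅x⁆; x∈⁅y⁆⇒x≡y; ∉⊥; ⊆-antisym)
open import Data.Integer.Base using (ℤ; +_; -[1+_]; +[1+_]; 0ℤ; 1ℤ; _+_; _-_; ∣_∣)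
open import Data.Integer.Tactic.RingSolver using (solve-∀)
open import Data.List.Base using ([]; _∷_; lookup; map; allFin; iterate)
open import Data.List.Membership.Propositional using (_∈_)
open import Data.List.Membership.Propositional.Properties
  using (∈-lookup; ∈-map⁺; ∈-map⁻; ∈-deduplicate⁺; ∈-deduplicate⁻; ∈-allFin)
open import Data.List.Properties using (length-deduplicate; length-map; length-tabulate)
open import Data.List.Relation.Unary.All as All using (All; []; _∷_)
open import Data.List.Relation.Unary.AllPairs using (_∷_)
open import Data.List.Relation.Unary.Any using (index)
open import Data.List.Relation.Unary.Any.Properties using (lookup-index)
open import Data.Nat.Base as ℕ using (ℕ; zero; suc; NonZero; _≤_)
open import Data.Product.Base using (∃-syntax; _×_; _,_; proj₁; proj₂)
open import Data.Sum.Base as Sum using (_⊎_; inj₁; inj₂)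
open import Function.Base using (_∘_; id)
open import Function.Bundles using (_⇔_; mk⇔; Inverse; module Inverse; module Equivalence)
open import Relation.Binary.Bundles using (module Setoid)
open import Relation.Binary.Construct.Closure.Equivalence using (EqClosure)
open import Relation.Binary.Construct.Closure.ReflexiveTransitive using (ε; _◅_; _◅◅_)
open import Relation.Binary.Construct.Closure.Symmetric using (fwd; bwd)
open import Relation.Binary.Definitions using (tri<; tri≈; tri>)
open import Relation.Binary.PropositionalEquality
  using (_≡_; refl; sym; trans; cong; cong₂; subst; subst₂; setoid)
open import Relation.Nullary.Decidable using (yes; no)
open import Relation.Nullary.Negation using (¬_; contradiction)

import Data.Bool.Properties as Bool
import Data.Integer.Base as ℤ
import Data.Integer.Properties as ℤ
import Data.Nat.Properties as ℕ
import Data.Vec.Base as Vec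
import Data.Vec.Functional as Vector
import Data.Vec.Properties as Vec
import Relation.Binary.Construct.Closure.Equivalence as EqClosure

-- Counting components

Connected : ∀ {m n} → (Fin m → Fin n × Fin n) → Fin n → Fin n → Set
Connected g = EqClosure (λ u v → ∃[ i ] g i ≡ (u , v))

connected-sym : ∀ {m n} (g : Fin m → Fin n × Fin n) {u v} → Connected g u v → Connected g v u
connected-sym g = EqClosure.symmetric _

Covers : ∀ {m n c} → (Fin m → Fin n × Fin n) → (Fin c → Fin n) → Set
Covers g s = ∀ w → ∃[ k ] Connected g w (s k)

module _ {m n : ℕ} (g : Fin (suc m) → Fin n × Fin n) where

  -- The part of the path after its last use of the edge zero.
  after-last-zero : ∀ {w v} → Connected g w v →
    Connected (g ∘ suc) w v ⊎
    Connected (g ∘ suc) (proj₁ (g zero)) v ⊎ Connected (g ∘ suc) (proj₂ (g zero)) v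
  after-last-zero ε = inj₁ ε
  after-last-zero (fwd (suc i , p) ◅ r) = Sum.map₁ (fwd (i , p) ◅_) (after-last-zero r)
  after-last-zero (bwd (suc i , p) ◅ r) = Sum.map₁ (bwd (i , p) ◅_) (after-last-zero r)
  after-last-zero (fwd (zero , p) ◅ r) with after-last-zero r
  ... | inj₁ q rewrite p = inj₂ (inj₂ q)
  ... | inj₂ q           = inj₂ q
  after-last-zero (bwd (zero , p) ◅ r) with after-last-zero r
  ... | inj₁ q rewrite p = inj₂ (inj₁ q)
  ... | inj₂ q           = inj₂ q

covers⇒≤ : ∀ m {n c} (g : Fin m → Fin n × Fin n) (s : Fin c → Fin n) → Covers g s → n ≤ c ℕ.+ m
covers⇒≤ zero {n} {c} g s cover = subst (n ≤_) (sym (ℕ.+-identityʳ c)) (injective⇒≤ injective)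
  where
  trivial : ∀ {u v} → Connected g u v → u ≡ v
  trivial ε                  = refl
  trivial (fwd (() , _) ◅ _)
  trivial (bwd (() , _) ◅ _)
  injective : ∀ {u v} → proj₁ (cover u) ≡ proj₁ (cover v) → u ≡ v
  injective {u} {v} eq =
    trans (trivial (proj₂ (cover u))) (trans (cong s eq) (sym (trivial (proj₂ (cover v)))))
covers⇒≤ (suc m) {n} {c} g s cover = subst (n ≤_) (sym (ℕ.+-suc c m)) shorter
  where
  a b : Fin n
  a = proj₁ (g zero)
  b = proj₂ (g zero)

  -- Without the edge zero, one of its ends p is still connected to s i, so
  -- adding the other end q to s repairs the cover.
  repair : ∀ {p q} i → Connected (g ∘ suc) p (s i) →
    (∀ {w v} → Connected g w v →
      Connected (g ∘ suc) w v ⊎ Connected (g ∘ suc) p v ⊎ Connected (g ∘ suc) q v) →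
    Covers (g ∘ suc) (q Vector.∷ s)
  repair i r after w with cover w
  ... | k , r′ with after (connected-sym g r′)
  ...   | inj₁ t        = suc k , connected-sym (g ∘ suc) t
  ...   | inj₂ (inj₁ t) = suc i , connected-sym (g ∘ suc) t ◅◅ r
  ...   | inj₂ (inj₂ t) = zero , connected-sym (g ∘ suc) t

  fromFirst : ∀ i → Connected (g ∘ suc) a (s i) → n ≤ suc (c ℕ.+ m)
  fromFirst i r = covers⇒≤ m (g ∘ suc) _ (repair i r (after-last-zero g))

  fromSecond : ∀ i → Connected (g ∘ suc) b (s i) → n ≤ suc (c ℕ.+ m)
  fromSecond i r = covers⇒≤ m (g ∘ suc) _ (repair i r (Sum.map₂ Sum.swap ∘ after-last-zero g))

  shorter : n ≤ suc (c ℕ.+ m)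
  shorter with cover a
  ... | i , r with after-last-zero g r
  ...   | inj₁ t        = fromFirst i t
  ...   | inj₂ (inj₁ t) = fromFirst i t
  ...   | inj₂ (inj₂ t) = fromSecond i t

tight-cover⇒bridge : ∀ {m n c} (g : Fin (suc m) → Fin n × Fin n) (s : Fin c → Fin n) →
  Covers g s → c ℕ.+ suc m ≡ n →
  ∀ i → ¬ Connected (g ∘ punchIn i) (proj₁ (g i)) (proj₂ (g i))
tight-cover⇒bridge {m} {n} {c} g s cover tight i bypass =
  contradiction (covers⇒≤ m _ s (λ w → let (k , r) = cover w in k , (reroute EqClosure.⋆) r))
    (ℕ.<⇒≱ (ℕ.≤-reflexive (trans (sym (ℕ.+-suc c m)) tight)))
  where
  reroute : ∀ {u v} → ∃[ j ] g j ≡ (u , v) → Connected (g ∘ punchIn i) u v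
  reroute (j , p) with i ≟ j
  ... | yes refl rewrite p = bypass
  ... | no i≢j = EqClosure.return (punchOut i≢j , trans (cong g (punchIn-punchOut i≢j)) p)

tight-cover⇒separated : ∀ {m n c} (g : Fin m → Fin n × Fin n) (s : Fin c → Fin n) →
  Covers g s → c ℕ.+ m ≡ n → ∀ {i j} → Connected g (s i) (s j) → i ≡ j
tight-cover⇒separated {m} {n} {suc c} g s cover tight {i} {j} joined with i ≟ j
... | yes i≡j = i≡j
... | no i≢j = contradiction (covers⇒≤ m g (s ∘ punchIn i) cover′) (ℕ.<⇒≱ (ℕ.≤-reflexive tight))
  where
  cover′ : Covers g (s ∘ punchIn i)
  cover′ w with cover w
  ... | k , r with i ≟ k
  ...   | yes refl = punchOut i≢j ,
                     subst (Connected g w ∘ s) (sym (punchIn-punchOut i≢j)) (r ◅◅ joined)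
  ...   | no i≢k   = punchOut i≢k ,
                     subst (Connected g w ∘ s) (sym (punchIn-punchOut i≢k)) r

module _ {n : ℕ} (G : Multigraph n) where
  open Multigraph G hiding (IsForest; IsComponent)

  infixr 5 _++ʷ_

  _++ʷ_ : ∀ {u v w} → Walk u v → Walk v w → Walk u w
  []         ++ʷ q = q
  step e j p ++ʷ q = step e j (p ++ʷ q)

  walk-sym : ∀ {u v} → Walk u v → Walk v u
  walk-sym []           = []
  walk-sym (step e j p) = walk-sym p ++ʷ step e (Sum.swap j) []

  module _ {m : ℕ} (edges : Inverse (setoid (Fin m)) edgeSetoid) where
    open Inverse edges using (to; from; inverseˡ)

    ends-to-from : ∀ e → ends (to (from e)) ≡ ends e
    ends-to-from e = ends-cong (inverseˡ refl)

    walk⇒connected : ∀ {l} (h : Fin l → Fin m) {u v} (w : Walk u v) →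
      All (λ e → ∃[ i ] h i ≡ from e) (walkEdges w) → Connected (ends ∘ to ∘ h) u v
    walk⇒connected h []           []             = ε
    walk⇒connected h (step e j w) ((i , p) ∷ ps) =
      Sum.[ (λ q → fwd (i , trans eq q)) , (λ q → bwd (i , trans eq q)) ] j ◅ walk⇒connected h w ps
      where
      eq : ends (to (h i)) ≡ ends e
      eq = trans (cong (ends ∘ to) p) (ends-to-from e)

    connected⇒walk : ∀ {u v} → Connected (ends ∘ to) u v → Walk u v
    connected⇒walk ε                 = []
    connected⇒walk (fwd (i , p) ◅ r) = step (to i) (inj₁ p) (connected⇒walk r)
    connected⇒walk (bwd (i , p) ◅ r) = step (to i) (inj₂ p) (connected⇒walk r)

  tight-cover⇒forest : ∀ {m c} (edges : Inverse (setoid (Fin m)) edgeSetoid) (s : Fin c → Fin n) →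
    Covers (ends ∘ Inverse.to edges) s → c ℕ.+ m ≡ n → IsForest G
  tight-cover⇒forest edges s cover tight [] cycle = IsCycle.nonempty cycle refl
  tight-cover⇒forest {zero} edges s cover tight (step e j w) cycle with () ← Inverse.from edges e
  tight-cover⇒forest {suc m} edges s cover tight (step {u} {v} e j w) cycle with IsCycle.distinctEdges cycle
  ... | e∉w ∷ _ = tight-cover⇒bridge (ends ∘ to) s cover tight (from e) bypass
    where
    open Inverse edges using (to; from; inverseˡ)
    open Setoid edgeSetoid using () renaming (sym to ≈-sym; trans to ≈-trans)

    back : Connected (ends ∘ to ∘ punchIn (from e)) v u
    back = walk⇒connected edges (punchIn (from e)) w (All.map
      (λ {e′} e≉e′ → let i≢j = λ eq → e≉e′ (≈-trans (≈-sym (inverseˡ refl)) (inverseˡ eq))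
                     in punchOut i≢j , punchIn-punchOut i≢j) e∉w)

    Bypassed : Fin n × Fin n → Set
    Bypassed (x , y) = Connected (ends ∘ to ∘ punchIn (from e)) x y

    bypass : Bypassed (ends (to (from e)))
    bypass = subst Bypassed (sym (ends-to-from edges e))
      (Sum.[ (λ p → subst Bypassed (sym p) (connected-sym _ back)) , (λ p → subst Bypassed (sym p) back) ] j)

module _ {n : ℕ} (π : Permutation′ n) where

  self∈cycleThrough : ∀ v → v ∈ₛ cycleThrough π v
  self∈cycleThrough v = go n v
    where
    go : ∀ m (u : Fin m) → v ∈ₛ ⋃ (map ⁅_⁆ (iterate (π ⟨$⟩ʳ_) v m))
    go (suc m) _ = x∈p∪q⁺ (inj₁ (x∈⁅x⁆ v))

  cycleThrough∈cycleSupports : ∀ v → cycleThrough π v ∈ cycleSupports π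
  cycleThrough∈cycleSupports v = ∈-deduplicate⁺ (Vec.≡-dec Bool._≟_) (∈-map⁺ (cycleThrough π) (∈-allFin v))

  cycleSupports⇒cycleThrough : ∀ {S} → S ∈ cycleSupports π → ∃[ v ] S ≡ cycleThrough π v
  cycleSupports⇒cycleThrough S∈ =
    let (v , _ , eq) = ∈-map⁻ (cycleThrough π)
                         (∈-deduplicate⁻ (Vec.≡-dec Bool._≟_) (map (cycleThrough π) (allFin n)) S∈)
    in v , eq

  cycleCount≤n : cycleCount π ≤ n
  cycleCount≤n = subst (cycleCount π ≤_)
    (trans (length-map (cycleThrough π) (allFin n)) (length-tabulate id))
    (length-deduplicate (Vec.≡-dec Bool._≟_) (map (cycleThrough π) (allFin n)))

  module _ (G : Multigraph n)
    (edges : Inverse (setoid (Fin (n ℕ.∸ cycleCount π))) (Multigraph.edgeSetoid G))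
    (connects : ∀ v → Multigraph.Walk G v (π ⟨$⟩ʳ v)) where
    open Multigraph G hiding (IsForest; IsComponent)

    ∈cycleThrough⇒walk : ∀ {v w} → w ∈ₛ cycleThrough π v → Walk v w
    ∈cycleThrough⇒walk {v} {w} = go n v
      where
      go : ∀ m u → w ∈ₛ ⋃ (map ⁅_⁆ (iterate (π ⟨$⟩ʳ_) u m)) → Walk u w
      go zero    u w∈ = contradiction w∈ ∉⊥
      go (suc m) u w∈ with x∈p∪q⁻ ⁅ u ⁆ _ w∈
      ... | inj₁ w∈u with refl ← x∈⁅y⁆⇒x≡y u w∈u = []
      ... | inj₂ w∈′ = _++ʷ_ G (connects u) (go m (π ⟨$⟩ʳ u) w∈′)

    private
      representative : Fin (cycleCount π) → Fin n
      representative k = proj₁ (cycleSupports⇒cycleThrough (∈-lookup {xs = cycleSupports π} k))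

      class : Fin n → Fin (cycleCount π)
      class v = index (cycleThrough∈cycleSupports v)

      lookup-class : ∀ v → cycleThrough π v ≡ lookup (cycleSupports π) (class v)
      lookup-class v = lookup-index (cycleThrough∈cycleSupports v)

      g : Fin (n ℕ.∸ cycleCount π) → Fin n × Fin n
      g = ends ∘ Inverse.to edges

      walk⇒connected-g : ∀ {u v} → Walk u v → Connected g u v
      walk⇒connected-g w = walk⇒connected G edges id w (All.universal (λ e → _ , refl) _)

      connected-representative : ∀ v → Connected g v (representative (class v))
      connected-representative v = connected-sym g (walk⇒connected-g (∈cycleThrough⇒walk
        (subst (v ∈ₛ_)
          (trans (lookup-class v)
            (proj₂ (cycleSupports⇒cycleThrough (∈-lookup {xs = cycleSupports π} (class v)))))
          (self∈cycleThrough v))))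

      cover : Covers g representative
      cover v = class v , connected-representative v

      tight : cycleCount π ℕ.+ (n ℕ.∸ cycleCount π) ≡ n
      tight = ℕ.m+[n∸m]≡n cycleCount≤n

    walk⇒∈cycleThrough : ∀ {v w} → Walk v w → w ∈ₛ cycleThrough π v
    walk⇒∈cycleThrough {v} {w} p = subst (w ∈ₛ_)
      (trans (lookup-class w) (trans (cong (lookup (cycleSupports π)) (sym same)) (sym (lookup-class v))))
      (self∈cycleThrough w)
      where
      same : class v ≡ class w
      same = tight-cover⇒separated g representative cover tight
        (connected-sym g (connected-representative v) ◅◅ walk⇒connected-g p ◅◅ connected-representative w)

    forest×components : IsForest G × (∀ S → IsComponent G S ⇔ S ∈ cycleSupports π)
    forest×components = tight-cover⇒forest G edges representative cover tight , λ S → mk⇔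
      (λ (v , S⇔v) → subst (_∈ cycleSupports π)
        (⊆-antisym (λ {w} w∈ → Equivalence.from (S⇔v w) (∈cycleThrough⇒walk w∈))
                   (λ {w} w∈ → walk⇒∈cycleThrough (Equivalence.to (S⇔v w) w∈)))
        (cycleThrough∈cycleSupports v))
      (λ S∈ → let (v , eq) = cycleSupports⇒cycleThrough S∈ in
        v , λ w → mk⇔ (∈cycleThrough⇒walk ∘ subst (w ∈ₛ_) eq) (subst (w ∈ₛ_) (sym eq) ∘ walk⇒∈cycleThrough))

-- Lattice paths

private
  +-suc-minus-one : ∀ x d → x + (1ℤ + d) - 1ℤ ≡ x + d
  +-suc-minus-one = solve-∀

  plus-minus-one : ∀ x → x + 1ℤ - 1ℤ ≡ x
  plus-minus-one = solve-∀

  shift-minus-one : ∀ x m → x + m - 1ℤ ≡ x - 1ℤ + m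
  shift-minus-one = solve-∀

  move-suc : ∀ x d → x + (1ℤ + d) ≡ x + 1ℤ + d
  move-suc = solve-∀

  minus-one-plus-suc : ∀ x d → x + d ≡ x - 1ℤ + (1ℤ + d)
  minus-one-plus-suc = solve-∀

  minus-plus : ∀ x y → x ≡ x - y + y
  minus-plus = solve-∀

⊖-⊕ : ∀ p q → p ≡ p ⊖ q ⊕ q
⊖-⊕ (x , y) (x′ , y′) = cong₂ _,_ (minus-plus x x′) (minus-plus y y′)

stationary⇒constant : ∀ {A : Set} (F : ℤ → A) → (∀ i → F i ≡ F (i - 1ℤ)) → ∀ i → F i ≡ F 0ℤ
stationary⇒constant F stationary (+ zero)     = refl
stationary⇒constant F stationary +[1+ m ]     =
  trans (stationary +[1+ m ]) (stationary⇒constant F stationary (+ m))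
stationary⇒constant F stationary -[1+ zero ]  = sym (stationary 0ℤ)
stationary⇒constant F stationary -[1+ suc m ] = trans
  (trans (cong (λ l → F -[1+ suc l ]) (sym (ℕ.+-identityʳ m))) (sym (stationary -[1+ m ])))
  (stationary⇒constant F stationary -[1+ m ])

module _ (Z : ℤ → ℤ) (increasing : ∀ i → Z (i - 1ℤ) ℤ.≤ Z i) where

  monotone-+ : ∀ i d → Z i ℤ.≤ Z (i + + d)
  monotone-+ i zero    = ℤ.≤-reflexive (cong Z (sym (ℤ.+-identityʳ i)))
  monotone-+ i (suc d) = ℤ.≤-trans (monotone-+ i d)
    (subst (λ l → Z l ℤ.≤ Z (i + + suc d)) (+-suc-minus-one i (+ d)) (increasing (i + + suc d)))

  no-repeat : ∀ {i j} → Z i ≡ Z (i - 1ℤ) + 1ℤ → Z (i - 1ℤ) ≡ Z (j - 1ℤ) → ¬ i ℤ.< j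
  no-repeat {i} {j} jump same i<j = ℤ.<⇒≱ strict (ℤ.≤-reflexive (sym same))
    where
    d : ℕ
    d = ∣ j - 1ℤ - i ∣

    i≤j-1 : i ℤ.≤ j - 1ℤ
    i≤j-1 = subst (i ℤ.≤_) (ℤ.+-comm (ℤ.- 1ℤ) j) (ℤ.i<j⇒i≤pred[j] i<j)

    lemma : ∀ i j → i + (j - i) ≡ j
    lemma = solve-∀

    gap : i + + d ≡ j - 1ℤ
    gap = trans (cong (λ z → i + z) (ℤ.0≤i⇒+∣i∣≡i (ℤ.i≤j⇒0≤j-i i≤j-1))) (lemma i (j - 1ℤ))

    strict : Z (i - 1ℤ) ℤ.< Z (j - 1ℤ)
    strict = ℤ.<-≤-trans
      (subst (Z (i - 1ℤ) ℤ.<_) (trans (ℤ.+-comm 1ℤ (Z (i - 1ℤ))) (sym jump)) (ℤ.suc[i]≤j⇒i<j ℤ.≤-refl))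
      (subst (λ l → Z i ℤ.≤ Z l) gap (monotone-+ i d))

  jump-injective : ∀ i j → Z i ≡ Z (i - 1ℤ) + 1ℤ → Z j ≡ Z (j - 1ℤ) + 1ℤ →
    Z (i - 1ℤ) ≡ Z (j - 1ℤ) → i ≡ j
  jump-injective i j jumpᵢ jumpⱼ same with ℤ.<-cmp i j
  ... | tri< i<j _ _ = contradiction i<j (no-repeat jumpᵢ same)
  ... | tri≈ _ i≡j _ = i≡j
  ... | tri> _ _ j<i = contradiction j<i (no-repeat jumpⱼ (sym same))

module _ {n k : ℕ} .{{_ : NonZero n}} (P : LatticePath n k) where
  open LatticePath P

  X Y : ℤ → ℤ
  X i = proj₁ (vertexAt steps i)
  Y i = proj₂ (vertexAt steps i)

  vertexAt-step : ∀ i → vertexAt steps i ≡ vertexAt steps (i - 1ℤ) ⊕ displacement (stepAt steps i)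
  vertexAt-step (+ zero) = ⊖-⊕ (0ℤ , 0ℤ) (displacement (stepAt steps 0ℤ))
  vertexAt-step +[1+ m ] = refl
  vertexAt-step -[1+ m ] = trans (⊖-⊕ _ _)
    (cong (λ l → vertexAt steps -[1+ suc l ] ⊕ displacement (stepAt steps -[1+ m ])) (sym (ℕ.+-identityʳ m)))

  vertexAt-along : ∀ i {s} → stepAt steps i ≡ s → vertexAt steps i ≡ vertexAt steps (i - 1ℤ) ⊕ displacement s
  vertexAt-along i refl = vertexAt-step i

  X-jump : ∀ i → stepAt steps i ≡ R → X i ≡ X (i - 1ℤ) + 1ℤ
  X-jump i stepR = cong proj₁ (vertexAt-along i stepR)

  X-constant : ∀ i → stepAt steps i ≡ U → X i ≡ X (i - 1ℤ)
  X-constant i stepU = trans (cong proj₁ (vertexAt-along i stepU)) (ℤ.+-identityʳ (X (i - 1ℤ)))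

  Y-jump : ∀ i → stepAt steps i ≡ U → Y i ≡ Y (i - 1ℤ) + 1ℤ
  Y-jump i stepU = cong proj₂ (vertexAt-along i stepU)

  Y-constant : ∀ i → stepAt steps i ≡ R → Y i ≡ Y (i - 1ℤ)
  Y-constant i stepR = trans (cong proj₂ (vertexAt-along i stepR)) (ℤ.+-identityʳ (Y (i - 1ℤ)))

  X-increasing : ∀ i → X (i - 1ℤ) ℤ.≤ X i
  X-increasing i rewrite vertexAt-step i with stepAt steps i
  ... | R = ℤ.i≤i+j _ 1ℤ
  ... | U = ℤ.i≤i+j _ 0ℤ

  Y-increasing : ∀ i → Y (i - 1ℤ) ℤ.≤ Y i
  Y-increasing i rewrite vertexAt-step i with stepAt steps i
  ... | R = ℤ.i≤i+j _ 0ℤ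
  ... | U = ℤ.i≤i+j _ 1ℤ

  stepAt-period : ∀ i → stepAt steps (i + + n) ≡ stepAt steps i
  stepAt-period i = cong (Vec.lookup steps)
    (trans (cong (λ z → residue (i + z)) (sym (ℤ.*-identityˡ (+ n)))) (residue-shift i 1ℤ))

  Y-period : ∀ i → Y (i + + n) ≡ Y i + + k
  Y-period i = trans (lemma₁ (Y (i + + n)) (Y i)) (cong (λ z → Y i + z)
    (trans (stationary⇒constant rise stationary i)
      (trans (lemma₂ (Y (0ℤ + + n))) (trans (cong Y (ℤ.+-identityˡ (+ n))) (cong proj₂ endpoint)))))
    where
    rise : ℤ → ℤ
    rise i = Y (i + + n) - Y i

    lemma₁ : ∀ x y → x ≡ y + (x - y)
    lemma₁ = solve-∀
    lemma₂ : ∀ x → x - 0ℤ ≡ x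
    lemma₂ = solve-∀
    lemma₃ : ∀ x y s → x + s - (y + s) ≡ x - y
    lemma₃ = solve-∀

    stationary : ∀ i → rise i ≡ rise (i - 1ℤ)
    stationary i = trans
      (cong₂ _-_ (trans (cong proj₂ (vertexAt-along (i + + n) (stepAt-period i)))
                   (cong (λ l → Y l + s) (shift-minus-one i (+ n))))
                 (cong proj₂ (vertexAt-step i)))
      (lemma₃ (Y (i - 1ℤ + + n)) (Y (i - 1ℤ)) s)
      where
      s : ℤ
      s = proj₂ (displacement (stepAt steps i))

  -- A box of the strip lies in the column below the northern edge column and in
  -- the row to the right of the northern edge row.
  record BoxIndex (b : Box) : Set where
    field
      column row : ℤ
      gap        : ℕ
      gap≡       : column ≡ row + + suc gap
      gap<n      : suc gap ≤ n
      columnStep : stepAt steps column ≡ R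
      rowStep    : stepAt steps row ≡ U
      x≡         : X (column - 1ℤ) ≡ proj₁ b
      y≡         : Y (row - 1ℤ) + + k ≡ proj₂ b

  boxIndex : ∀ {b} → InStrip P b → BoxIndex b
  boxIndex {x , y} (i , stepR , x≡ , south , north) =
    descend n 0 (i - 1ℤ) (minus-plus i 1ℤ) refl north
    where
    height : ℤ → ℤ
    height j = Y j + + k

    descend : ∀ m d j → i ≡ j + + suc d → d ℕ.+ m ≡ n → y + 1ℤ ℤ.≤ height j → BoxIndex (x , y)
    descend zero d j i≡ d+m≡n above = contradiction (ℤ.≤-trans above below)
      (ℤ.<⇒≱ (subst (y ℤ.<_) (ℤ.+-comm 1ℤ y) (ℤ.suc[i]≤j⇒i<j ℤ.≤-refl)))
      where
      below : height j ℤ.≤ y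
      below = subst (ℤ._≤ y) (trans (cong Y (trans (cong (_- 1ℤ) i≡)
        (trans (+-suc-minus-one j (+ d)) (cong (λ l → j + + l) (trans (sym (ℕ.+-identityʳ d)) d+m≡n)))))
        (Y-period j)) south
    descend (suc m) d j i≡ d+m≡n above with (y + 1ℤ) ℤ.≤? height (j - 1ℤ)
    ... | yes above′ = descend m (suc d) (j - 1ℤ) (trans i≡ (minus-one-plus-suc j (+ suc d)))
                         (trans (sym (ℕ.+-suc d m)) d+m≡n) above′
    ... | no ¬above′ with stepAt steps j in eq
    ...   | R = contradiction (subst (λ z → y + 1ℤ ℤ.≤ z + + k)
                  (Y-constant j eq) above) ¬above′
    ...   | U = record
      { column = i
      ; row = j
      ; gap = d
      ; gap≡ = i≡
      ; gap<n = subst (suc d ≤_) d+m≡n (subst (suc d ≤_) (sym (ℕ.+-suc d m)) (ℕ.m≤m+n (suc d) m))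
      ; columnStep = stepR
      ; rowStep = eq
      ; x≡ = x≡
      ; y≡ = ℤ.≤-antisym upper lower
      }
      where
      upper : height (j - 1ℤ) ℤ.≤ y
      upper = subst (height (j - 1ℤ) ℤ.≤_) (trans (ℤ.+-comm (ℤ.- 1ℤ) (y + 1ℤ)) (plus-minus-one y))
        (ℤ.i<j⇒i≤pred[j] (ℤ.≰⇒> ¬above′))

      regroup : ∀ x → x + 1ℤ + + k - 1ℤ ≡ x + + k
      regroup x = lemma x (+ k)
        where
        lemma : ∀ x m → x + 1ℤ + m - 1ℤ ≡ x + m
        lemma = solve-∀

      lower : y ℤ.≤ height (j - 1ℤ)
      lower = subst₂ ℤ._≤_ (plus-minus-one y)
        (trans (cong (λ z → z + + k - 1ℤ) (Y-jump j eq)) (regroup (Y (j - 1ℤ))))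
        (ℤ.+-monoˡ-≤ (ℤ.- 1ℤ) above)

  inStrip : ∀ d i j → i ≡ j + + suc d → suc d ≤ n → stepAt steps i ≡ R → stepAt steps j ≡ U →
    InStrip P (X (i - 1ℤ) , Y (j - 1ℤ) + + k)
  inStrip d i j refl d<n stepR stepU = i , stepR , refl , south , north
    where
    south : Y (i - 1ℤ) ℤ.≤ Y (j - 1ℤ) + + k
    south = subst₂ ℤ._≤_
      (cong Y (sym (shift-minus-one j (+ suc d))))
      (trans (cong Y (trans (ℤ.+-assoc (j - 1ℤ) (+ suc d) (+ (n ℕ.∸ suc d)))
        (cong (λ l → j - 1ℤ + + l) (ℕ.m+[n∸m]≡n d<n)))) (Y-period (j - 1ℤ)))
      (monotone-+ Y Y-increasing (j - 1ℤ + + suc d) (n ℕ.∸ suc d))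

    north : Y (j - 1ℤ) + + k + 1ℤ ℤ.≤ Y (i - 1ℤ) + + k
    north = subst₂ ℤ._≤_
      (trans (cong (_+ + k) (Y-jump j stepU)) (swap (Y (j - 1ℤ)) 1ℤ (+ k)))
      (cong (λ l → Y l + + k) (sym (+-suc-minus-one j (+ d))))
      (ℤ.+-monoˡ-≤ (+ k) (monotone-+ Y Y-increasing j d))
      where
      swap : ∀ x y z → x + y + z ≡ x + z + y
      swap = solve-∀

  -- The edge lies in the column below, resp. the row to the right of, the
  -- northern edge t.
  Straight : UnitEdge → ℤ → Set
  Straight ((x , y) , s) t =
    stepAt steps t ≡ s × (s ≡ R → X (t - 1ℤ) ≡ x) × (s ≡ U → Y (t - 1ℤ) + + k ≡ y)

  straight-southEdge : ∀ j t → Straight (southEdge P j) t → residue {n} t ≡ residue j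
  straight-southEdge j t (same , x≡ , y≡) with stepAt steps j in eq
  ... | R = cong residue (jump-injective X X-increasing t j (X-jump t same) (X-jump j eq) (x≡ refl))
  ... | U = trans (trans (sym (residue-shift t 1ℤ)) (cong (λ z → residue (t + z)) (ℤ.*-identityˡ (+ n))))
    (cong residue (jump-injective Y Y-increasing (t + + n) j
      (Y-jump (t + + n) (trans (stepAt-period t) same)) (Y-jump j eq)
      (trans (trans (cong Y (shift-minus-one t (+ n))) (Y-period (t - 1ℤ))) (y≡ refl))))

module _ {n k : ℕ} .{{_ : NonZero n}} (P : LatticePath n k) (A : Filling P) where
  open LatticePath P
  open Filling A using (tile)
  open Multigraph (deograph A) using (Walk; []; step)

  infixr 5 _++ᵈ_
  _++ᵈ_ : ∀ {u v w} → Walk u v → Walk v w → Walk u w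
  _++ᵈ_ = _++ʷ_ (deograph A)

  Strand : ℤ → UnitEdge → Set
  Strand a e = ∃[ ℓ ] Reaches A a e ℓ

  Linked : UnitEdge → ℤ → Set
  Linked e t = ∃[ a ] Strand a e × Walk (residue a) (residue t)

  elbow-walk : ∀ {b a c} (p : InStrip P b) → tile b p ≡ elbow →
    Strand a (leftEdge b) → Strand c (topEdge b) → Walk (residue a) (residue c)
  elbow-walk p isElbow (_ , l) (_ , u) = step elbowAt (inj₁ refl) []
    where
    elbowAt : Elbow A
    elbowAt = record { inStrip = p ; isElbow = isElbow ; leftStrand = l ; topStrand = u }

  exitLeft : ∀ {b a t} (p : InStrip P b) → tile b p ≡ t → Strand a (leftEdge b) → Strand a (exitFromLeft t b)
  exitLeft p refl (_ , r) = _ , fromLeft p r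

  exitTop : ∀ {b a t} (p : InStrip P b) → tile b p ≡ t → Strand a (topEdge b) → Strand a (exitFromTop t b)
  exitTop p refl (_ , r) = _ , fromTop p r

  pass : ∀ {b i j} → InStrip P b → Linked (leftEdge b) j → Linked (topEdge b) i →
    Linked (rightEdge b) j × Linked (bottomEdge b) i
  pass {b} p (a , l , a~j) (c , u , c~i) with tile b p in eq
  ... | crossing = (a , exitLeft p eq l , a~j) , (c , exitTop p eq u , c~i)
  ... | elbow    = (c , exitTop p eq u , walk-sym (deograph A) (elbow-walk p eq l u) ++ᵈ a~j) ,
                   (a , exitLeft p eq l , elbow-walk p eq l u ++ᵈ c~i)

  -- The boxes are indexed by pairs j < i ≤ j + n with step i right and step j
  -- up; going back along a strand decreases i - j.
  linked-vertical : ∀ d i j → i ≡ j + + suc d → suc d ≤ n → stepAt steps j ≡ U →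
    Linked ((X P (i - 1ℤ) , Y P (j - 1ℤ) + + k) , U) j

  linked-horizontal : ∀ d i j → i ≡ j + + d → d ≤ n → stepAt steps i ≡ R →
    Linked ((X P (i - 1ℤ) , Y P (j - 1ℤ) + + k) , R) i

  linked-box : ∀ d i j → i ≡ j + + suc d → suc d ≤ n → stepAt steps i ≡ R → stepAt steps j ≡ U →
    let b = X P (i - 1ℤ) , Y P (j - 1ℤ) + + k in Linked (leftEdge b) j × Linked (topEdge b) i
  linked-box d i j i≡ d<n stepR stepU = linked-vertical d i j i≡ d<n stepU ,
    subst (λ p → Linked (p , R) i) (cong₂ _,_ (sym (ℤ.+-identityʳ _)) top)
      (linked-horizontal d i (j + 1ℤ) (trans i≡ (move-suc j (+ d))) (ℕ.<⇒≤ d<n) stepR)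
    where
    swap : ∀ x y z → x + y + z ≡ x + z + y
    swap = solve-∀
    top : Y P (j + 1ℤ - 1ℤ) + + k ≡ Y P (j - 1ℤ) + + k + 1ℤ
    top = trans (cong (λ l → Y P l + + k) (plus-minus-one j))
            (trans (cong (_+ + k) (Y-jump P j stepU)) (swap (Y P (j - 1ℤ)) 1ℤ (+ k)))

  linked-exits : ∀ d i j → i ≡ j + + suc d → suc d ≤ n → stepAt steps i ≡ R → stepAt steps j ≡ U →
    let b = X P (i - 1ℤ) , Y P (j - 1ℤ) + + k in Linked (rightEdge b) j × Linked (bottomEdge b) i
  linked-exits d i j i≡ d<n stepR stepU = let (l , u) = linked-box d i j i≡ d<n stepR stepU in
    pass {i = i} {j} (inStrip P d i j i≡ d<n stepR stepU) l u

  linked-vertical zero i j i≡ d<n stepU = j , ([] , subst (λ e → Reaches A j e []) north start) , []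
    where
    north : northEdge P j ≡ ((X P (i - 1ℤ) , Y P (j - 1ℤ) + + k) , U)
    north = cong₂ _,_ (cong₂ _,_ (trans (sym (cong proj₁ (vertexAt-along P j stepU)))
      (cong (X P) (sym (trans (cong (_- 1ℤ) i≡) (plus-minus-one j))))) refl) stepU
  linked-vertical (suc d) i j i≡ d<n stepU = extend (stepAt steps (i - 1ℤ)) refl
    where
    i-1≡ : i - 1ℤ ≡ j + + suc d
    i-1≡ = trans (cong (_- 1ℤ) i≡) (+-suc-minus-one j (+ suc d))

    extend : ∀ s → stepAt steps (i - 1ℤ) ≡ s → Linked ((X P (i - 1ℤ) , Y P (j - 1ℤ) + + k) , U) j
    extend R stepR = subst (λ p → Linked (p , U) j)
      (cong₂ _,_ (sym (X-jump P (i - 1ℤ) stepR)) (ℤ.+-identityʳ _))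
      (proj₁ (linked-exits d (i - 1ℤ) j i-1≡ (ℕ.<⇒≤ d<n) stepR stepU))
    extend U stepU′ = subst (λ x → Linked ((x , Y P (j - 1ℤ) + + k) , U) j)
      (sym (X-constant P (i - 1ℤ) stepU′))
      (linked-vertical d (i - 1ℤ) j i-1≡ (ℕ.<⇒≤ d<n) stepU)

  linked-horizontal zero i j i≡ d≤n stepR = i , ([] , subst (λ e → Reaches A i e []) north start) , []
    where
    north : northEdge P i ≡ ((X P (i - 1ℤ) , Y P (j - 1ℤ) + + k) , R)
    north = cong₂ _,_ (cong₂ _,_ (ℤ.+-identityʳ _)
      (cong (λ l → Y P (l - 1ℤ) + + k) (trans i≡ (ℤ.+-identityʳ j)))) stepR
  linked-horizontal (suc d) i j i≡ d≤n stepR = extend (stepAt steps j) refl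
    where
    extend : ∀ s → stepAt steps j ≡ s → Linked ((X P (i - 1ℤ) , Y P (j - 1ℤ) + + k) , R) i
    extend R stepR′ = subst (λ y → Linked ((X P (i - 1ℤ) , y + + k) , R) i)
      (trans (cong (Y P) (plus-minus-one j)) (Y-constant P j stepR′))
      (linked-horizontal d i (j + 1ℤ) (trans i≡ (move-suc j (+ d))) (ℕ.<⇒≤ d≤n) stepR)
    extend U stepU = proj₂ (linked-exits d i j i≡ d≤n stepR stepU)

  record Crossroads (b : Box) : Set where
    field
      column row     : ℤ
      leftLinked     : Linked (leftEdge b) row
      topLinked      : Linked (topEdge b) column
      rightStraight  : Straight P (rightEdge b) row
      bottomStraight : Straight P (bottomEdge b) column

  crossroads : ∀ {b} → InStrip P b → Crossroads b
  crossroads p with boxIndex P p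
  ... | record { column = i ; row = j ; gap = d ; gap≡ = i≡ ; gap<n = d<n
                 ; columnStep = stepR ; rowStep = stepU ; x≡ = refl ; y≡ = refl } =
    let (l , u) = linked-box d i j i≡ d<n stepR stepU in record
    { column         = i
    ; row            = j
    ; leftLinked     = l
    ; topLinked      = u
    ; rightStraight  = stepU , (λ ()) , (λ _ → sym (ℤ.+-identityʳ _))
    ; bottomStraight = stepR , (λ _ → refl) , (λ ())
    }

  reaches⇒straight : ∀ {a e ℓ} → Reaches A a e ℓ → ∃[ t ] Straight P e t × Walk (residue a) (residue t)
  reaches⇒straight {a} start = a , (refl , (λ _ → sym (ℤ.+-identityʳ _)) , (λ _ → refl)) , []
  reaches⇒straight {a} (fromLeft {b} p r) with tile b p in eq
  ... | crossing = let (t , (stepU , _ , y≡) , a~t) = reaches⇒straight r in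
    t , (stepU , (λ ()) , λ q → trans (y≡ q) (sym (ℤ.+-identityʳ _))) , a~t
  ... | elbow = let (_ , u , c~i) = topLinked in
    column , bottomStraight , elbow-walk p eq (_ , r) u ++ᵈ c~i
    where open Crossroads (crossroads p)
  reaches⇒straight {a} (fromTop {b} p r) with tile b p in eq
  ... | crossing = let (t , (stepR , x≡ , _) , a~t) = reaches⇒straight r in
    t , (stepR , (λ q → trans (x≡ q) (ℤ.+-identityʳ _)) , (λ ())) , a~t
  ... | elbow = let (_ , l , c~j) = leftLinked in
    row , rightStraight , walk-sym (deograph A) (elbow-walk p eq l (_ , r)) ++ᵈ c~j
    where open Crossroads (crossroads p)

  walk-reduce : ∀ f → HasStrandPermutation A f → ∀ v → Walk v (reduce f ⟨$⟩ʳ v)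
  walk-reduce f strands v =
    let (_ , r) = strands (label v) ; (t , s , w) = reaches⇒straight r in
    subst₂ Walk (residue-unique v 0ℤ (sym (ℤ.+-identityʳ (label v))))
      (straight-southEdge P (apply f (label v)) t s) w

proposition3p14 : (n k : ℕ) .{{_ : NonZero n}} → k ≤ n →
    (f : AffinePermutation n) → Bounded k f →
    (P : LatticePath n k) (A : Filling P) → IsMaximalDeogram A f →
    IsForest (deograph A) ×
    (∀ (S : Subset n) → IsComponent (deograph A) S ⇔ S ∈ cycleSupports (reduce f))
proposition3p14 n k _ f _ P A maximal = forest×components (reduce f) (deograph A) elbowCount
  (walk-reduce P A f (IsDeogram.strandPermutation isDeogram))
  where open IsMaximalDeogram maximal
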